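{- Let $k=2$. There is an algorithm that, given a temporal star $(G_s,L)$ on $n$ vertices in which every edge has at most $2$ labels, computes a (partial) exploration of $(G_s,L)$ of maximum size (i.e.\ solves \textsc{MaxStarExp(2)}) in $O(n\log n)$ time.
   Context: A temporal graph is a pair $(G,L)$ where $G=(V,E)$ is a graph and $L:E\to 2^{\mathbb{N}}$ assigns to each edge a set of positive integer labels (the discrete times at which the edge is available). A temporal star is a temporal graph whose underlying graph $G_s$ is a star with center $c$ and $n-1$ leaves. A time edge is a triple $(u,v,l)$ with $\{u,v\}\in E$ and $l\in L(\{u,v\})$. A journey from $u$ to $v$ is a sequence of time edges $(u,u_1,l_1),(u_1,u_2,l_2),\dots,(u_{r-1},v,l_r)$ with $l_1<l_2<\dots<l_r$. A (partial) exploration of a temporal star is a journey that starts and ends at the center $c$; its size is the number of leaves it visits (equivalently, the number of edges of the star it explores, where an edge $\{c,v\}$ is explored by entering it from $c$ to $v$ at one of its labels and later exiting it from $v$ to $c$ at a strictly larger label). The problem \textsc{MaxStarExp($k$)} takes as input a temporal star in which every edge has at most $k$ labels and asks for a (partial) exploration of maximum size. -}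

module Defs where

open import Data.Bool using (if_then_else_)
open import Data.Fin using (Fin; toℕ)
import Data.Fin.Properties as Fin
open import Data.List using (List; []; _∷_; [_]; _++_; map; concatMap; filter; length; allFin)
open import Data.List.Membership.Propositional using (_∈_)
open import Data.List.Membership.DecPropositional using () renaming (_∈?_ to mem?)
open import Data.List.Relation.Unary.All using (All)
open import Data.List.Relation.Unary.Linked using (Linked)
open import Data.List.Relation.Unary.Unique.Propositional using (Unique)
open import Data.Nat using (ℕ; _+_; _*_; _∸_; _≤_; _<_; _≟_)
open import Data.Product using (∃-syntax; _×_)
open import Data.Sum using (_⊎_)
open import Function using (_⇔_; _on_)
open import Level using (0ℓ)
open import Relation.Binary using (Rel; Symmetric; Irreflexive)
open import Relation.Binary.PropositionalEquality using (_≡_; _≢_)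
open import Relation.Nullary using (does; ¬?)

record Graph (n : ℕ) : Set₁ where
  field
    _~_    : Rel (Fin n) 0ℓ
    ~-sym  : Symmetric _~_
    ~-irr  : Irreflexive _≡_ _~_

-- The finite label set of {u , v} is listed, in no particular order and
-- without repetition, by `labels u v`.  `labels` is total only for
-- convenience: its values off the edges are never consulted.

record TemporalGraph (n : ℕ) : Set₁ where
  field
    graph : Graph n
  open Graph graph public
  field
    labels          : Fin n → Fin n → List ℕ
    labels-sym      : ∀ {u v} → u ~ v → labels u v ≡ labels v u
    labels-unique   : ∀ {u v} → u ~ v → Unique (labels u v)
    labels-positive : ∀ {u v} → u ~ v → All (0 <_) (labels u v)

IsStar : ∀ {n} → Graph n → Fin n → Set
IsStar G c = ∀ u v → (u ~ v) ⇔ ((u ≡ c × v ≢ c) ⊎ (u ≢ c × v ≡ c))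
  where open Graph G

record TemporalStar (n : ℕ) : Set₁ where
  field
    temporalGraph : TemporalGraph n
  open TemporalGraph temporalGraph public
  field
    center : Fin n
    isStar : IsStar graph center

AtMostLabels : ∀ {n} → ℕ → TemporalGraph n → Set
AtMostLabels k G = ∀ {u v} → u ~ v → length (labels u v) ≤ k
  where open TemporalGraph G

record TimeEdge (n : ℕ) : Set where
  constructor timeEdge
  field
    source : Fin n
    target : Fin n
    time   : ℕ

open TimeEdge public

module _ {n} (G : TemporalGraph n) where
  open TemporalGraph G

  IsTimeEdge : TimeEdge n → Set
  IsTimeEdge e = (source e ~ target e) × (time e ∈ labels (source e) (target e))

  data Walk : Fin n → Fin n → List (TimeEdge n) → Set where
    []  : ∀ {u} → Walk u u []
    _∷_ : ∀ {e es v} → IsTimeEdge e → Walk (target e) v es →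
          Walk (source e) v (e ∷ es)

  IsJourney : Fin n → Fin n → List (TimeEdge n) → Set
  IsJourney u v es = Walk u v es × Linked (_<_ on time) es

module _ {n} (S : TemporalStar n) where
  open TemporalStar S

  leaves : List (Fin n)
  leaves = filter (λ v → ¬? (v Fin.≟ center)) (allFin n)

  IsExploration : List (TimeEdge n) → Set
  IsExploration = IsJourney temporalGraph center center

  -- Since an exploration starts at the center, the leaves it visits are
  -- those occurring as targets of its time edges; repeated visits to the
  -- same leaf count once.

  size : List (TimeEdge n) → ℕ
  size es = length (filter (λ v → mem? Fin._≟_ v (map target es)) leaves)

  IsMaximumExploration : List (TimeEdge n) → Set
  IsMaximumExploration es =
    IsExploration es × (∀ es′ → IsExploration es′ → size es′ ≤ size es)

-- A RAM with registers, an addressable memory, a read-only input tape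
-- and a write-only output tape, all holding natural numbers, programmed
-- with structured control flow.  Costs follow the uniform criterion:
-- one unit per command executed (per test for a loop, none for _⨾_) and one per node
-- of each expression evaluated.  The only arithmetic is + and ∸, so that
-- unit cost does not hide superpolynomial computations.

data Expr : Set where
  const     : ℕ → Expr
  reg       : ℕ → Expr
  load      : Expr → Expr
  _⊕_ _⊖_   : Expr → Expr → Expr

data Program : Set where
  skip    : Program
  _≔_     : ℕ → Expr → Program
  store   : (address value : Expr) → Program
  read    : ℕ → Program
  write   : Expr → Program
  _⨾_     : Program → Program → Program
  ifNZ    : Expr → Program → Program → Program
  whileNZ : Expr → Program → Program

infixl 6 _⊕_ _⊖_
infix  4 _≔_
infixr 3 _⨾_

record State : Set where
  constructor state
  field
    registers : ℕ → ℕ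
    memory    : ℕ → ℕ
    input     : List ℕ
    output    : List ℕ

open State public

_[_↦_] : (ℕ → ℕ) → ℕ → ℕ → (ℕ → ℕ)
(f [ i ↦ x ]) j = if does (j ≟ i) then x else f j

⟦_⟧ : Expr → State → ℕ
⟦ const x ⟧ s = x
⟦ reg r   ⟧ s = registers s r
⟦ load a  ⟧ s = memory s (⟦ a ⟧ s)
⟦ a ⊕ b   ⟧ s = ⟦ a ⟧ s + ⟦ b ⟧ s
⟦ a ⊖ b   ⟧ s = ⟦ a ⟧ s ∸ ⟦ b ⟧ s

cost : Expr → ℕ
cost (const _) = 1
cost (reg _)   = 1
cost (load a)  = 1 + cost a
cost (a ⊕ b)   = 1 + cost a + cost b
cost (a ⊖ b)   = 1 + cost a + cost b

setReg : ℕ → ℕ → State → State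
setReg r x s = record s { registers = registers s [ r ↦ x ] }

setMem : ℕ → ℕ → State → State
setMem a x s = record s { memory = memory s [ a ↦ x ] }

-- Reading past the end of the input yields 0.

readInto : ℕ → State → State
readInto r (state ρ μ []       out) = state (ρ [ r ↦ 0 ]) μ [] out
readInto r (state ρ μ (x ∷ xs) out) = state (ρ [ r ↦ x ]) μ xs out

emit : ℕ → State → State
emit x s = record s { output = output s ++ [ x ] }

-- ⟨ p , s ⟩⇓⟨ s′ , t ⟩: started in s, the program p halts in s′ after
-- t units of time.

data ⟨_,_⟩⇓⟨_,_⟩ : Program → State → State → ℕ → Set where
  skip : ∀ {s} →
    ⟨ skip , s ⟩⇓⟨ s , 1 ⟩
  assign : ∀ {r e s} →
    ⟨ r ≔ e , s ⟩⇓⟨ setReg r (⟦ e ⟧ s) s , 1 + cost e ⟩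
  store : ∀ {a e s} →
    ⟨ store a e , s ⟩⇓⟨ setMem (⟦ a ⟧ s) (⟦ e ⟧ s) s , 1 + cost a + cost e ⟩
  read : ∀ {r s} →
    ⟨ read r , s ⟩⇓⟨ readInto r s , 1 ⟩
  write : ∀ {e s} →
    ⟨ write e , s ⟩⇓⟨ emit (⟦ e ⟧ s) s , 1 + cost e ⟩
  seq : ∀ {p q s s′ s″ t t′} →
    ⟨ p , s ⟩⇓⟨ s′ , t ⟩ → ⟨ q , s′ ⟩⇓⟨ s″ , t′ ⟩ →
    ⟨ p ⨾ q , s ⟩⇓⟨ s″ , t + t′ ⟩
  if-nonzero : ∀ {e p q s s′ t} →
    ⟦ e ⟧ s ≢ 0 → ⟨ p , s ⟩⇓⟨ s′ , t ⟩ →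
    ⟨ ifNZ e p q , s ⟩⇓⟨ s′ , 1 + cost e + t ⟩
  if-zero : ∀ {e p q s s′ t} →
    ⟦ e ⟧ s ≡ 0 → ⟨ q , s ⟩⇓⟨ s′ , t ⟩ →
    ⟨ ifNZ e p q , s ⟩⇓⟨ s′ , 1 + cost e + t ⟩
  while-nonzero : ∀ {e p s s′ s″ t t′} →
    ⟦ e ⟧ s ≢ 0 → ⟨ p , s ⟩⇓⟨ s′ , t ⟩ → ⟨ whileNZ e p , s′ ⟩⇓⟨ s″ , t′ ⟩ →
    ⟨ whileNZ e p , s ⟩⇓⟨ s″ , 1 + cost e + t + t′ ⟩
  while-zero : ∀ {e p s} →
    ⟦ e ⟧ s ≡ 0 →
    ⟨ whileNZ e p , s ⟩⇓⟨ s , 1 + cost e ⟩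

initial : List ℕ → State
initial xs = state (λ _ → 0) (λ _ → 0) xs []

Computes_on_to_within_ : Program → List ℕ → List ℕ → ℕ → Set
Computes p on xs to ys within b =
  ∃[ s ] ∃[ t ] (⟨ p , initial xs ⟩⇓⟨ s , t ⟩ × output s ≡ ys × t ≤ b)

-- A star is presented as n, the center, and then for every leaf v the
-- block v, |L({c , v})| and the labels of {c , v}.

encodeStar : ∀ {n} → TemporalStar n → List ℕ
encodeStar {n} S = n ∷ toℕ center ∷ concatMap block (leaves S)
  where
  open TemporalStar S
  block : Fin n → List ℕ
  block v = toℕ v ∷ length (labels center v) ∷ labels center v

encodeJourney : ∀ {n} → List (TimeEdge n) → List ℕ
encodeJourney = concatMap λ e → toℕ (source e) ∷ toℕ (target e) ∷ time e ∷ []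

_SolvesMaxStarExp⟨_⟩InTime_ : Program → ℕ → (ℕ → ℕ) → Set₁
p SolvesMaxStarExp⟨ k ⟩InTime T =
  ∀ {n} (S : TemporalStar n) → AtMostLabels k (TemporalStar.temporalGraph S) →
  ∃[ es ] (IsMaximumExploration S es ×
           Computes p on encodeStar S to encodeJourney es within T n)

_∈O_ : (ℕ → ℕ) → (ℕ → ℕ) → Set
f ∈O g = ∃[ C ] ∃[ N ] (∀ n → N ≤ n → f n ≤ C * g n)

infix 4 _∈O_

{-# OPTIONS --safe #-}
module Submission where

-- An edge contributes to an exploration only if it is entered at its smaller and left at its larger
-- label, so every edge with two labels is an interval and an exploration is a sequence of intervals
-- each of which is entered strictly after the previous one was left.  Repeatedly choosing the
-- compatible interval that exits first is optimal.  Up to the sorting by exits this is a linear scan,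
-- and the sorting is a merge sort on a queue of runs: repeatedly the two runs in front are merged and
-- the result is appended at the back.  A round through the queue takes linear time and halves the
-- number of runs.

open import Defs
open import Data.Nat using (ℕ; _*_)
open import Data.Nat.Logarithm using (⌈log₂_⌉)
open import Data.Product using (∃-syntax; _×_)

open import Data.Empty using (⊥)
open import Data.Fin using (Fin; toℕ)
open import Data.List using (List; []; _∷_; [_]; _++_; map; concat; concatMap; length; reverse; merge; allFin)
open import Data.List.Membership.Propositional using (_∈_; lose)
open import Data.List.Membership.Propositional.Properties using (∈-filter⁺; ∈-filter⁻; ∈-allFin; ∈-map⁻; ∈-∃++; ∈-++⁻; ∈-++⁺ˡ; ∈-++⁺ʳ; ∈-concatMap⁺; ∈-concatMap⁻)
open import Data.List.Properties using (++-assoc; ++-identityʳ; length-++; unfold-reverse; ∷ʳ-++; map-++; concat-++; length-filter; length-tabulate; length-map; reverse-involutive; concat-map-[_])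
open import Data.List.Relation.Binary.Permutation.Propositional using (_↭_; ↭-refl; ↭-trans; ↭-reflexive; ↭-sym; module PermutationReasoning)
open import Data.List.Relation.Binary.Permutation.Propositional.Properties using (↭-length; merge-↭; ++⁺ˡ; ++-comm; ↭-reverse; All-resp-↭; ∈-resp-↭)
open import Data.List.Relation.Unary.All as All using (All; []; _∷_)
import Data.List.Relation.Unary.All.Properties as All
open import Data.List.Relation.Unary.AllPairs using (AllPairs; []; _∷_)
import Data.List.Relation.Unary.AllPairs.Properties as AllPairs
open import Data.List.Relation.Unary.Any using (Any; here; there)
open import Data.List.Relation.Unary.Linked using (Linked; []; [-]; _∷_)
open import Data.List.Relation.Unary.Linked.Properties using (Linked⇒AllPairs)
open import Data.List.Relation.Unary.Sorted.TotalOrder using (Sorted)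
open import Data.List.Relation.Unary.Sorted.TotalOrder.Properties using (merge⁺)
open import Data.List.Relation.Unary.Unique.Propositional using (Unique)
import Data.List.Relation.Unary.Unique.Propositional.Properties as Unique
open import Data.Nat hiding (_*_; ℕ)
open import Data.Nat.Logarithm using (⌈log₂⌉-mono-≤; ⌈log₂⌈n/2⌉⌉≡⌈log₂n⌉∸1; ⌈log₂2*n⌉≡1+⌈log₂n⌉)
open import Data.Nat.Properties
open import Data.Nat.Tactic.RingSolver using (solve-∀)
open import Data.Product using (_,_; proj₁; proj₂)
open import Data.Sum using (inj₁; inj₂)
open import Data.Unit using (⊤)
open import Function using (_∘_; flip; _on_; Equivalence)
open import Level using (0ℓ)
open import Relation.Binary using (Decidable; DecTotalOrder; Rel)
import Relation.Binary.Construct.Flip.EqAndOrd as Flip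
import Relation.Binary.Construct.On as On
open import Relation.Binary.PropositionalEquality hiding ([_])
open import Relation.Nullary using (Dec; yes; no; contradiction; recompute)
open import Relation.Nullary.Decidable using (dec-true; dec-false)

-- The bound of two labels is what makes intervals countable: an edge then offers at most one
-- interval, so compatible intervals belong to distinct leaves and the size of an exploration is the
-- number of its intervals. With four labels, two compatible intervals could share a leaf. Runs are
-- kept in descending order of exits because 0, which no exit equals, then acts as the least element
-- in merging; the final scan therefore reads the sorted run backwards. Merged runs always go to
-- fresh memory, so every preservation argument reduces to agreement below `Top`.

private variable
  n : ℕ
  A : Set

-- Hoare-style reasoning with time bounds

-- A total-correctness triple for a single start state. The time is bounded rather than exact, so
-- that branches of different duration can share one bound.
record Run (p : Program) (s : State) (b : ℕ) (Q : State → Set) : Set where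
  constructor run
  field
    {final}  : State
    {time}   : ℕ
    halts    : ⟨ p , s ⟩⇓⟨ final , time ⟩
    time≤    : time ≤ b
    post     : Q final

module _ {Q : State → Set} where

  run-≤ : ∀ {p s b b′} → b ≤ b′ → Run p s b Q → Run p s b′ Q
  run-≤ b≤b′ (run h t q) = run h (≤-trans t b≤b′) q

  run-map : ∀ {p s b P} → (∀ {s′} → P s′ → Q s′) → Run p s b P → Run p s b Q
  run-map f (run h t x) = run h t (f x)

  infixr 1 _>>=_
  _>>=_ : ∀ {p q s b b′ P} → Run p s b P → (∀ {s′} → P s′ → Run q s′ b′ Q) →
          Run (p ⨾ q) s (b + b′) Q
  run h t x >>= k with run h′ t′ y ← k x = run (seq h h′) (+-mono-≤ t t′) y

  run-then : ∀ {e p q s b} → ⟦ e ⟧ s ≢ 0 → Run p s b Q →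
             Run (ifNZ e p q) s (1 + cost e + b) Q
  run-then e≢0 (run h t x) = run (if-nonzero e≢0 h) (+-monoʳ-≤ _ t) x

  run-else : ∀ {e p q s b} → ⟦ e ⟧ s ≡ 0 → Run q s b Q →
             Run (ifNZ e p q) s (1 + cost e + b) Q
  run-else e≡0 (run h t x) = run (if-zero e≡0 h) (+-monoʳ-≤ _ t) x

  run-iterate : ∀ {e p s b b′ P} → ⟦ e ⟧ s ≢ 0 → Run p s b P →
                (∀ {s′} → P s′ → Run (whileNZ e p) s′ b′ Q) →
                Run (whileNZ e p) s (1 + cost e + b + b′) Q
  run-iterate e≢0 (run h t x) k with run h′ t′ y ← k x =
    run (while-nonzero e≢0 h h′) (+-mono-≤ (+-monoʳ-≤ _ t) t′) y

  run-stop : ∀ {e p s} → ⟦ e ⟧ s ≡ 0 → Q s → Run (whileNZ e p) s (1 + cost e) Q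
  run-stop e≡0 x = run (while-zero e≡0) ≤-refl x

Straight : Program → Set
Straight (p ⨾ q)       = Straight p × Straight q
Straight (ifNZ _ _ _)  = ⊥
Straight (whileNZ _ _) = ⊥
Straight _             = ⊤

-- Loop-free code is run by normalisation, so that facts about its final state hold definitionally.
-- The catch-all clause is a dummy, ruled out by `Straight`, whose proofs are products of units and
-- are inferred.
exec : Program → State → State
exec skip        s = s
exec (r ≔ e)     s = setReg r (⟦ e ⟧ s) s
exec (store a e) s = setMem (⟦ a ⟧ s) (⟦ e ⟧ s) s
exec (read r)    s = readInto r s
exec (write e)   s = emit (⟦ e ⟧ s) s
exec (p ⨾ q)     s = exec q (exec p s)
exec _           s = s

duration : Program → ℕ
duration (_ ≔ e)     = 1 + cost e
duration (store a e) = 1 + cost a + cost e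
duration (write e)   = 1 + cost e
duration (p ⨾ q)     = duration p + duration q
duration _           = 1

exec-⇓ : ∀ p {_ : Straight p} {s} → ⟨ p , s ⟩⇓⟨ exec p s , duration p ⟩
exec-⇓ skip        = skip
exec-⇓ (r ≔ e)     = assign
exec-⇓ (store a e) = store
exec-⇓ (read r)    = read
exec-⇓ (write e)   = write
exec-⇓ (p ⨾ q) {x , y} = seq (exec-⇓ p {x}) (exec-⇓ q {y})

straight : ∀ p {x : Straight p} {s} {Q : State → Set} → Q (exec p s) → Run p s (duration p) Q
straight p {x} q = run (exec-⇓ p {x}) ≤-refl q

straight-then : ∀ p {x : Straight p} {q s b} {Q : State → Set} →
                Run q (exec p s) b Q → Run (p ⨾ q) s (duration p + b) Q
straight-then p {x} (run h t y) = run (seq (exec-⇓ p {x}) h) (+-monoʳ-≤ (duration p) t) y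

-- Intervals and their layout in memory

-- The inequality is irrelevant, so an interval is determined by its leaf and its two times,
-- whichever comparison produced it; `enter<exit′` recovers the proof by deciding the inequality
-- again.
record Interval (n : ℕ) : Set where
  constructor interval
  field
    leaf        : Fin n
    enter exit  : ℕ
    .enter<exit : enter < exit

open Interval

enter<exit′ : (r : Interval n) → enter r < exit r
enter<exit′ (interval _ a b a<b) = recompute (a <? b) a<b

exit≢0 : (r : Interval n) → exit r ≢ 0
exit≢0 r = m<n⇒n≢0 (enter<exit′ r)

_≥ᵉ_ : ∀ {n} → Interval n → Interval n → Set
r ≥ᵉ r′ = exit r′ ≤ exit r

_≥ᵉ?_ : ∀ {n} → Decidable (_≥ᵉ_ {n})
r ≥ᵉ? r′ = exit r′ ≤? exit r

-- `Stored μ i rs e`: the intervals rs occupy the addresses from i up to, but excluding, e.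

data Stored (μ : ℕ → ℕ) : ℕ → List (Interval n) → ℕ → Set where
  []    : ∀ {i} → Stored μ {n} i [] i
  cons  : ∀ {i r} {rs : List (Interval n)} {e} →
          μ i ≡ exit r → μ (1 + i) ≡ enter r → μ (2 + i) ≡ toℕ (leaf r) →
          Stored μ (3 + i) rs e → Stored μ i (r ∷ rs) e

-- A 0 terminates every run; no interval can be mistaken for it, as its first word, its exit, is positive.

data Queue (μ : ℕ → ℕ) : ℕ → List (List (Interval n)) → ℕ → Set where
  []   : ∀ {i} → Queue μ {n} i [] i
  cons : ∀ {i x e} {q : List (List (Interval n))} {t} →
         Stored μ i x e → μ e ≡ 0 → Queue μ (1 + e) q t → Queue μ i (x ∷ q) t

-- The frame condition: the program writes only at or above `Top`, so whatever is stored below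
-- survives.
_agreesWith_below_ : (ℕ → ℕ) → (ℕ → ℕ) → ℕ → Set
μ′ agreesWith μ below t = ∀ {i} → i < t → μ′ i ≡ μ i

stored-≤ : ∀ {μ i e} {rs : List (Interval n)} → Stored μ i rs e → i ≤ e
stored-≤ []             = ≤-refl
stored-≤ (cons _ _ _ x) = ≤-trans (m≤n+m _ 3) (stored-≤ x)

queue-≤ : ∀ {μ i t} {q : List (List (Interval n))} → Queue μ i q t → i ≤ t
queue-≤ []           = ≤-refl
queue-≤ (cons x _ q) = ≤-trans (stored-≤ x) (≤-trans (n≤1+n _) (queue-≤ q))

module _ {μ μ′ : ℕ → ℕ} {t} (eq : μ′ agreesWith μ below t) where

  stored-keep : ∀ {i e} {rs : List (Interval n)} → e ≤ t → Stored μ i rs e → Stored μ′ i rs e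
  stored-keep e≤t [] = []
  stored-keep e≤t (cons x y z s) =
    cons (trans (eq i<t) x) (trans (eq 1+i<t) y) (trans (eq 2+i<t) z) (stored-keep e≤t s)
    where
    2+i<t = ≤-trans (stored-≤ s) e≤t
    1+i<t = <-trans (n<1+n _) 2+i<t
    i<t   = <-trans (n<1+n _) 1+i<t

  queue-keep : ∀ {i e} {q : List (List (Interval n))} → e ≤ t → Queue μ i q e → Queue μ′ i q e
  queue-keep e≤t [] = []
  queue-keep e≤t (cons x y q) =
    cons (stored-keep (<⇒≤ e<t) x) (trans (eq e<t) y) (queue-keep e≤t q)
    where e<t = ≤-trans (queue-≤ q) e≤t

stored-++⁻ : ∀ {μ i e} (rs : List (Interval n)) {rs′} → Stored μ i (rs ++ rs′) e →
             ∃[ m ] (Stored μ i rs m × Stored μ m rs′ e)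
stored-++⁻ []       s = _ , [] , s
stored-++⁻ (r ∷ rs) (cons x y z s) with m , s₁ , s₂ ← stored-++⁻ rs s = m , cons x y z s₁ , s₂

queue-snoc : ∀ {μ i t e} {q : List (List (Interval n))} {x} →
             Queue μ i q t → Stored μ t x e → μ e ≡ 0 → Queue μ i (q ++ [ x ]) (1 + e)
queue-snoc []           x e = cons x e []
queue-snoc (cons y d q) x e = cons y d (queue-snoc q x e)

update-same : ∀ (f : ℕ → ℕ) i x → (f [ i ↦ x ]) i ≡ x
update-same f i x rewrite dec-true (i ≟ i) refl = refl

update-other : ∀ (f : ℕ → ℕ) {i j} x → j ≢ i → (f [ i ↦ x ]) j ≡ f j
update-other f {i} {j} x j≢i rewrite dec-false (j ≟ i) j≢i = refl

-- The memory left by `push`, nested exactly as `exec push` computes it. Constants stand on the left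
-- of sums, here and in the program, so that addresses reduce to successors.
write₃ : (ℕ → ℕ) → ℕ → ℕ → ℕ → ℕ → (ℕ → ℕ)
write₃ μ t x y z = ((μ [ t ↦ x ]) [ 1 + t ↦ y ]) [ 2 + t ↦ z ]

update-keeps : ∀ (μ : ℕ → ℕ) {t x} → (μ [ t ↦ x ]) agreesWith μ below t
update-keeps μ {x = x} i<t = update-other μ x (<⇒≢ i<t)

append-run : ∀ {μ μ′ i t e} {q : List (List (Interval n))} {x} →
             Queue μ i q t → Stored μ′ t x e → μ′ agreesWith μ below t →
             Queue (μ′ [ e ↦ 0 ]) i (q ++ [ x ]) (1 + e)
append-run {μ = μ} {μ′} {e = e} q x same =
  queue-snoc
    (queue-keep {μ = μ} (λ i<t → trans (update-keeps μ′ (<-≤-trans i<t (stored-≤ x))) (same i<t)) ≤-refl q)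
    (stored-keep {μ = μ′} (update-keeps μ′) ≤-refl x) (update-same μ′ e 0)

module _ (μ : ℕ → ℕ) (t x y z : ℕ) where

  private
    μ₁ = μ [ t ↦ x ]
    μ₂ = μ₁ [ 1 + t ↦ y ]
    t<1+t = n<1+n t
    1+t<2+t = n<1+n (1 + t)
    t<2+t = <-trans t<1+t 1+t<2+t

  write₃-keeps : write₃ μ t x y z agreesWith μ below t
  write₃-keeps i<t =
    trans (update-keeps μ₂ (<-trans i<t t<2+t))
      (trans (update-keeps μ₁ (<-trans i<t t<1+t)) (update-keeps μ i<t))

  write₃-0 : write₃ μ t x y z t ≡ x
  write₃-0 = trans (update-keeps μ₂ t<2+t) (trans (update-keeps μ₁ t<1+t) (update-same μ t x))

  write₃-1 : write₃ μ t x y z (1 + t) ≡ y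
  write₃-1 = trans (update-keeps μ₂ 1+t<2+t) (update-same μ₁ (1 + t) y)

  write₃-2 : write₃ μ t x y z (2 + t) ≡ z
  write₃-2 = update-same μ₂ (2 + t) z

-- The RAM program

Count Center Runs Head Next Top Exit Enter Leaf Size Finish : ℕ
Count  = 0
Center = 1
Runs   = 2
Head   = 3
Next   = 4
Top    = 5
Exit   = 6
Enter  = 7
Leaf   = 8
Size   = 9
Finish = 10

push endRun : Program
push =
  store (reg Top) (reg Exit) ⨾
  store (const 1 ⊕ reg Top) (reg Enter) ⨾
  store (const 2 ⊕ reg Top) (reg Leaf) ⨾
  Top ≔ const 3 ⊕ reg Top
endRun =
  store (reg Top) (const 0) ⨾
  Top ≔ const 1 ⊕ reg Top

move : ℕ → Program
move p =
  Exit  ≔ load (reg p) ⨾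
  Enter ≔ load (const 1 ⊕ reg p) ⨾
  Leaf  ≔ load (const 2 ⊕ reg p) ⨾
  p ≔ const 3 ⊕ reg p ⨾
  push

-- At the end of a run the exit loaded is the terminator 0, which loses every comparison, so that
-- mergeRuns needs no separate treatment of a run that is exhausted before the other.

findEnd mergeRuns mergeStart mergeEnd mergeFirstTwo mergeQueue : Program
findEnd = whileNZ (load (reg Next)) (Next ≔ const 3 ⊕ reg Next)
mergeRuns =
  whileNZ (load (reg Head) ⊕ load (reg Next))
    (ifNZ (load (reg Next) ⊖ load (reg Head)) (move Next) (move Head))
mergeStart = Next ≔ const 1 ⊕ reg Next
mergeEnd =
  endRun ⨾
  Head ≔ const 1 ⊕ reg Next ⨾
  Runs ≔ reg Runs ⊖ const 1
mergeFirstTwo = (Next ≔ reg Head) ⨾ findEnd ⨾ mergeStart ⨾ mergeRuns ⨾ mergeEnd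
mergeQueue = whileNZ (reg Runs ⊖ const 1) mergeFirstTwo

-- Since reading past the end of the input yields 0, reading n blocks is harmless although there are
-- only n - 1 leaves: the surplus block has no labels.

insert order readInterval readBlock readAll : Program
insert = push ⨾ endRun ⨾ Runs ≔ const 1 ⊕ reg Runs
order =
  read Exit ⨾
  Size  ≔ reg Enter ⊕ (reg Exit ⊖ reg Enter) ⨾
  Enter ≔ reg Enter ⊖ (reg Enter ⊖ reg Exit) ⨾
  Exit  ≔ reg Size
readInterval =
  order ⨾
  ifNZ (reg Exit ⊖ reg Enter) insert skip
readBlock =
  (Count ≔ reg Count ⊖ const 1 ⨾ read Leaf ⨾ read Size) ⨾
  ifNZ (reg Size) (read Enter ⨾ ifNZ (reg Size ⊖ const 1) readInterval skip) skip
readAll = whileNZ (reg Count) readBlock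

select back visit schedule : Program
select =
  Exit ≔ load (reg Next) ⨾
  Leaf ≔ load (const 2 ⊕ reg Next) ⨾
  write (reg Center) ⨾
  write (reg Leaf) ⨾
  write (reg Enter) ⨾
  write (reg Leaf) ⨾
  write (reg Center) ⨾
  write (reg Exit) ⨾
  Finish ≔ reg Exit
back =
  Next  ≔ reg Next ⊖ const 3 ⨾
  Enter ≔ load (const 1 ⊕ reg Next)
visit = back ⨾ ifNZ (reg Enter ⊖ reg Finish) select skip
schedule = whileNZ (reg Next ⊖ reg Head) visit

start maxStarExp : Program
start =
  read Count ⨾ read Center ⨾ store (const 0) (const 0) ⨾ Top ≔ const 1 ⨾ Runs ≔ const 1
maxStarExp =
  -- The word just below `Top` is the terminator of the only run left.
  start ⨾ readAll ⨾ mergeQueue ⨾ Next ≔ reg Top ⊖ const 1 ⨾ schedule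

-- Merging two runs

infix 8 _at_
_at_ : State → ℕ → ℕ
s at r = registers s r

-- P collects the facts that the loop does not disturb.

findEnd-run : ∀ (P : State → Set) → (∀ s k → P s → P (setReg Next k s)) →
              ∀ (x : List (Interval n)) {s e} →
              P s → Stored (memory s) (s at Next) x e → memory s e ≡ 0 →
              Run findEnd s (length x * 7 + 3) (λ s′ → P s′ × s′ at Next ≡ e)
findEnd-run P ok [] p [] z = run-stop z (p , refl)
findEnd-run P ok (r ∷ x) {s} p (cons e _ _ st) z =
  run-iterate {P = λ s′ → s′ ≡ exec (Next ≔ const 3 ⊕ reg Next) s} (λ eq → exit≢0 r (trans (sym e) eq))
    (straight (Next ≔ const 3 ⊕ reg Next) refl) λ { refl → findEnd-run P ok x (ok s _ p) st z }

merge-[] : (x : List (Interval n)) → merge _≥ᵉ?_ x [] ≡ x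
merge-[] []      = refl
merge-[] (_ ∷ _) = refl

-- Per interval: 6 for the loop test, 6 for the comparison and 34 for `move`. The 6 added in
-- `mergeTime` is the failing test at the end.
MergeCost : ℕ
MergeCost = 46

mergeTime : List (Interval n) → List (Interval n) → ℕ
mergeTime x y = (length x + length y) * MergeCost + 6

record Merging (P : State → Set) (x y : List (Interval n)) (hₑ nₑ : ℕ) (s : State) : Set where
  constructor merging
  field
    context : P s
    left    : Stored (memory s) (s at Head) x hₑ
    left0   : memory s hₑ ≡ 0
    left<   : hₑ < s at Top
    right   : Stored (memory s) (s at Next) y nₑ
    right0  : memory s nₑ ≡ 0
    right<  : nₑ < s at Top

-- `t` is the value of `Top` before merging. The rest of the queue lies below it, and `same` is what
-- carries it over to the new memory.
record Merged (P : State → Set) (z : List (Interval n)) (nₑ : ℕ) (μ : ℕ → ℕ) (t : ℕ) (s : State) : Set where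
  constructor merged
  field
    context : P s
    next    : s at Next ≡ nₑ
    result  : Stored (memory s) t z (s at Top)
    same    : memory s agreesWith μ below t

module _ (P : State → Set)
         (okH : ∀ s → P s → P (exec (move Head) s)) (okN : ∀ s → P s → P (exec (move Next) s)) where

  -- The continuation starts with `Top` at `3 + t` and preserves everything below, hence also the
  -- three words of `r` just written at `t`.
  merged-cons : ∀ {r : Interval n} {z nₑ μ t a b c s} → a ≡ exit r → b ≡ enter r → c ≡ toℕ (leaf r) →
                Merged P z nₑ (write₃ μ t a b c) (3 + t) s → Merged P (r ∷ z) nₑ μ t s
  merged-cons {μ = μ} {t} {a} {b} {c} ex en le (merged p nx res same) = merged p nx
    (cons (trans (same (m<n⇒m<1+n (m<n⇒m<1+n ≤-refl))) (trans (write₃-0 μ t a b c) ex))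
          (trans (same (m<n⇒m<1+n ≤-refl)) (trans (write₃-1 μ t a b c) en))
          (trans (same ≤-refl) (trans (write₃-2 μ t a b c) le)) res)
    λ i<t → trans (same (<-≤-trans i<t (m≤n+m _ 3))) (write₃-keeps μ t a b c i<t)

  merging-head : ∀ {r : Interval n} {x y hₑ nₑ s} →
                 Merging P (r ∷ x) y hₑ nₑ s → Merging P x y hₑ nₑ (exec (move Head) s)
  merging-head {s = s} (merging p (cons _ _ _ l) l0 l< r r0 r<) = merging (okH s p)
      (stored-keep keep (<⇒≤ l<) l) (trans (keep l<) l0) (<-≤-trans l< (m≤n+m _ 3))
      (stored-keep keep (<⇒≤ r<) r) (trans (keep r<) r0) (<-≤-trans r< (m≤n+m _ 3))
    where
    keep : write₃ (memory s) (s at Top) _ _ _ agreesWith memory s below (s at Top)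
    keep = write₃-keeps (memory s) _ _ _ _

  merging-next : ∀ {r : Interval n} {x y hₑ nₑ s} →
                 Merging P x (r ∷ y) hₑ nₑ s → Merging P x y hₑ nₑ (exec (move Next) s)
  merging-next {s = s} (merging p l l0 l< (cons _ _ _ r) r0 r<) = merging (okN s p)
      (stored-keep keep (<⇒≤ l<) l) (trans (keep l<) l0) (<-≤-trans l< (m≤n+m _ 3))
      (stored-keep keep (<⇒≤ r<) r) (trans (keep r<) r0) (<-≤-trans r< (m≤n+m _ 3))
    where
    keep : write₃ (memory s) (s at Top) _ _ _ agreesWith memory s below (s at Top)
    keep = write₃-keeps (memory s) _ _ _ _

  move-head : ∀ {r : Interval n} {x y z hₑ nₑ s b} → memory s (s at Head) + memory s (s at Next) ≢ 0 →
              memory s (s at Next) ∸ memory s (s at Head) ≡ 0 →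
              Merging P (r ∷ x) y hₑ nₑ s →
              (∀ {s} → Merging P x y hₑ nₑ s → Run mergeRuns s b (Merged P z nₑ (memory s) (s at Top))) →
              Run mergeRuns s (MergeCost + b) (Merged P (r ∷ z) nₑ (memory s) (s at Top))
  move-head {s = s} go h≥n m@(merging _ (cons ex en le _) _ _ _ _ _) k =
    -- Equality with the computed state, as the intermediate assertion, lets the rest of the loop
    -- start from that very state.
    run-iterate {P = λ s′ → s′ ≡ exec (move Head) s} go (run-else h≥n (straight (move Head) refl))
      λ { refl → run-map (merged-cons ex en le) (k (merging-head m)) }

  move-next : ∀ {r : Interval n} {x y z hₑ nₑ s b} → memory s (s at Head) + memory s (s at Next) ≢ 0 →
              memory s (s at Next) ∸ memory s (s at Head) ≢ 0 →
              Merging P x (r ∷ y) hₑ nₑ s →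
              (∀ {s} → Merging P x y hₑ nₑ s → Run mergeRuns s b (Merged P z nₑ (memory s) (s at Top))) →
              Run mergeRuns s (MergeCost + b) (Merged P (r ∷ z) nₑ (memory s) (s at Top))
  move-next {s = s} go n>h m@(merging _ _ _ _ (cons ex en le _) _ _) k =
    run-iterate {P = λ s′ → s′ ≡ exec (move Next) s} go (run-then n>h (straight (move Next) refl))
      λ { refl → run-map (merged-cons ex en le) (k (merging-next m)) }

  -- Rewriting by the outcome of the comparison reduces `merge` to the branch that the program
  -- takes; on a tie both prefer the interval at `Head`. The two recursive calls of `mergeRuns-run`
  -- come in as arguments.
  mergeRuns-step : ∀ {r r′ : Interval n} {x y hₑ nₑ s} → Dec (r ≥ᵉ r′) → Merging P (r ∷ x) (r′ ∷ y) hₑ nₑ s →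
    (∀ {s} → Merging P x (r′ ∷ y) hₑ nₑ s →
     Run mergeRuns s (mergeTime x (r′ ∷ y)) (Merged P (merge _≥ᵉ?_ x (r′ ∷ y)) nₑ (memory s) (s at Top))) →
    (∀ {s} → Merging P (r ∷ x) y hₑ nₑ s →
     Run mergeRuns s (mergeTime (r ∷ x) y) (Merged P (merge _≥ᵉ?_ (r ∷ x) y) nₑ (memory s) (s at Top))) →
    Run mergeRuns s (mergeTime (r ∷ x) (r′ ∷ y))
        (Merged P (merge _≥ᵉ?_ (r ∷ x) (r′ ∷ y)) nₑ (memory s) (s at Top))
  mergeRuns-step {r = r} {r′} {x} {y} (yes r≥r′) m@(merging p (cons ex _ _ _) _ _ (cons ex′ _ _ _) _ _) k _
    rewrite dec-true (r ≥ᵉ? r′) r≥r′ =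
    move-head (λ eq → exit≢0 r (trans (sym ex) (m+n≡0⇒m≡0 _ eq)))
      (trans (cong₂ _∸_ ex′ ex) (m≤n⇒m∸n≡0 r≥r′)) m k
  mergeRuns-step {r = r} {r′} {x} {y} (no r≱r′) m@(merging p (cons ex _ _ _) _ _ (cons ex′ _ _ _) _ _) _ k
    rewrite dec-false (r ≥ᵉ? r′) r≱r′ | +-suc (length x) (length y) =
    move-next (λ eq → exit≢0 r (trans (sym ex) (m+n≡0⇒m≡0 _ eq)))
      (λ eq → m>n⇒m∸n≢0 (≰⇒> r≱r′) (trans (sym (cong₂ _∸_ ex′ ex)) eq)) m k

  mergeRuns-run : ∀ (x y : List (Interval n)) {hₑ nₑ s} → Merging P x y hₑ nₑ s →
                  Run mergeRuns s (mergeTime x y) (Merged P (merge _≥ᵉ?_ x y) nₑ (memory s) (s at Top))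
  mergeRuns-run [] [] (merging p [] l0 _ [] r0 _) =
    run-stop (cong₂ _+_ l0 r0) (merged p refl [] λ _ → refl)
  mergeRuns-run [] (r ∷ y) {s = s} m@(merging p [] l0 _ (cons ex _ _ _) _ _) =
    move-next (λ eq → exit≢0 r (trans (sym ex) (m+n≡0⇒n≡0 _ eq)))
      (λ eq → exit≢0 r (trans (sym ex) (trans (cong (memory s (s at Next) ∸_) (sym l0)) eq)))
      m (mergeRuns-run [] y)
  mergeRuns-run (r ∷ x) [] {nₑ = nₑ} {s} m@(merging p (cons ex _ _ _) _ _ [] r0 _) =
    move-head (λ eq → exit≢0 r (trans (sym ex) (m+n≡0⇒m≡0 _ eq)))
      (trans (cong (_∸ memory s (s at Head)) r0) (0∸n≡0 (memory s (s at Head))))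
      -- `merge` matches its first list first, so it does not reduce on a variable `x` followed by
      -- `[]`.
      m λ {s} m → subst (λ z → Run mergeRuns s (mergeTime x []) (Merged P z nₑ (memory s) (s at Top)))
                  (merge-[] x) (mergeRuns-run x [] m)
  mergeRuns-run (r ∷ x) (r′ ∷ y) m =
    mergeRuns-step (r ≥ᵉ? r′) m (λ m → mergeRuns-run x (r′ ∷ y) m) (λ m → mergeRuns-run (r ∷ x) y m)

-- The queue of runs

-- The common invariant of reading and merging; `finish` and `out` carry the initial values through
-- to the scheduling phase.
record Sorting (c : ℕ) (q : List (List (Interval n))) (s : State) : Set where
  constructor sorting
  field
    runs    : s at Runs ≡ length q
    centre  : s at Center ≡ c
    finish  : s at Finish ≡ 0
    out     : output s ≡ []
    queue   : Queue (memory s) (s at Head) q (s at Top)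

Context : ℕ → ℕ → State → Set
Context k c s = s at Runs ≡ k × s at Center ≡ c × s at Finish ≡ 0 × output s ≡ []

mergeFirstTime : List (Interval n) → List (Interval n) → ℕ
mergeFirstTime x y = 2 + (length x * 7 + 3 + (4 + (mergeTime x y + 15)))

mergeFirstTwo-run : ∀ {c s} {x y : List (Interval n)} {q} → Sorting c (x ∷ y ∷ q) s →
                    Run mergeFirstTwo s (mergeFirstTime x y) (Sorting c (q ++ [ merge _≥ᵉ?_ x y ]))
mergeFirstTwo-run {c = c} {s} {x} {y} {q} (sorting k ce f o (cons {e = e} st z (cons {e = e′} st′ z′ qu))) =
  straight (Next ≔ reg Head) {Q = λ s → P s × s at Next ≡ s at Head} (((k , ce , f , o) , st , z , cons st′ z′ qu) , refl) >>=
  λ { {s} (p@(_ , st , z , _) , eq) →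
  findEnd-run P (λ _ _ p → p) x p (subst (λ i → Stored (memory s) i x e) (sym eq) st) z >>=
  λ { {s} ((ctx , st , z , cons {e = e′} st′ z′ qu) , refl) →
  straight (Next ≔ const 1 ⊕ reg Next)
    {Q = λ s → Merging (Context (2 + length q) c) x y e e′ s × Queue (memory s) (1 + e′) q (s at Top)}
    (merging ctx st z (≤-trans (stored-≤ st′) (≤-trans (n≤1+n _) (queue-≤ qu))) st′ z′ (queue-≤ qu) , qu) >>=
  λ { {s} (m , qu) →
  mergeRuns-run (Context (2 + length q) c) (λ _ p → p) (λ _ p → p) x y m >>=
  λ { {s} (merged (k , ce , f , o) refl res same) →
  -- `mergeRuns` stops with `Next` on the terminator of the second run, so `mergeEnd` sets `Head` to
  -- the start of the third.
  straight mergeEnd (sorting (trans (cong (_∸ 1) k) (trans (+-comm 1 (length q)) (sym (length-++ q)))) ce f o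
    (append-run qu res same)) }}}}
  where
  P : State → Set
  P s = Context (2 + length q) c s × Stored (memory s) (s at Head) x e × memory s e ≡ 0 ×
        Queue (memory s) (1 + e) (y ∷ q) (s at Top)

-- One round through the queue; a run left over by an odd number of runs opens the next round.

mergePairs : List (List (Interval n)) → List (List (Interval n)) → List (List (Interval n))
mergePairs (x ∷ y ∷ q) acc = mergePairs q (acc ++ [ merge _≥ᵉ?_ x y ])
mergePairs (x ∷ [])    acc = x ∷ acc
mergePairs []          acc = acc

-- Counting the sentinel of every run makes the cost of a pass linear in the weight.

weight : List (List (Interval n)) → ℕ
weight q = length (concat q) + length q

-- `MergeCost` plus the 7 units that `findEnd` spends on an interval of the first run. At this rate
-- the sentinels of two runs contribute 106, enough for the overhead of 34 of each merge.
PassCost : ℕ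
PassCost = 53

mergeFirst-≤ : ∀ (x y : List (Interval n)) → 4 + mergeFirstTime x y ≤ (length x + length y + 2) * PassCost
mergeFirst-≤ x y = begin
  4 + mergeFirstTime x y                                     ≡⟨ lhs (length x) (length y) ⟩
  length x * 53 + length y * 46 + 34                         ≤⟨ +-mono-≤ (+-monoʳ-≤ (length x * 53) (*-monoʳ-≤ (length y) (m≤m+n 46 7))) (m≤m+n 34 72) ⟩
  length x * 53 + length y * 53 + 106                        ≡⟨ rhs (length x) (length y) ⟩
  (length x + length y + 2) * PassCost                       ∎
  where
  open ≤-Reasoning
  lhs : ∀ a b → 4 + (2 + (a * 7 + 3 + (4 + ((a + b) * 46 + 6 + 15)))) ≡ a * 53 + b * 46 + 34
  lhs = solve-∀
  rhs : ∀ a b → a * 53 + b * 53 + 106 ≡ (a + b + 2) * 53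
  rhs = solve-∀

weight-∷∷ : ∀ (x y : List (Interval n)) q → (length x + length y + 2) + weight q ≡ weight (x ∷ y ∷ q)
weight-∷∷ x y q rewrite length-++ x {y ++ concat q} | length-++ y {concat q} =
  lemma (length x) (length y) (length (concat q)) (length q)
  where
  lemma : ∀ a b c d → (a + b + 2) + (c + d) ≡ a + (b + c) + (2 + d)
  lemma = solve-∀

-- The loop itself knows no rounds; the continuation cuts it where `q`, the part of the queue
-- belonging to this round, has been used up. `acc` holds the runs that the round has already
-- produced behind `q`. A leftover run is not touched and costs nothing.
pass-run : ∀ {c s b} {Q : State → Set} (q acc : List (List (Interval n))) → Sorting c (q ++ acc) s →
           (∀ {s} → Sorting c (mergePairs q acc) s → Run mergeQueue s b Q) →
           Run mergeQueue s (weight q * PassCost + b) Q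
pass-run []       acc st k = k st
pass-run {b = b} (x ∷ []) acc st k = run-≤ (m≤n+m b _) (k st)
pass-run {b = b} (x ∷ y ∷ q) acc st k =
  run-≤ (begin
      4 + mergeFirstTime x y + (weight q * PassCost + b)  ≡⟨ +-assoc (4 + mergeFirstTime x y) _ b ⟨
      4 + mergeFirstTime x y + weight q * PassCost + b    ≤⟨ +-monoˡ-≤ b (+-monoˡ-≤ _ (mergeFirst-≤ x y)) ⟩
      (length x + length y + 2) * PassCost + weight q * PassCost + b
        ≡⟨ cong (_+ b) (*-distribʳ-+ PassCost (length x + length y + 2) (weight q)) ⟨
      (length x + length y + 2 + weight q) * PassCost + b ≡⟨ cong (λ w → w * PassCost + b) (weight-∷∷ x y q) ⟩
      weight (x ∷ y ∷ q) * PassCost + b                   ∎)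
    (run-iterate (λ eq → 1+n≢0 (trans (sym (cong (_∸ 1) (Sorting.runs st))) eq)) (mergeFirstTwo-run st)
      λ st → pass-run q (acc ++ [ merge _≥ᵉ?_ x y ])
        (subst (λ q → Sorting _ q _) (++-assoc q acc _) st) k)
  where open ≤-Reasoning

≥ᵉ-decTotalOrder : ℕ → DecTotalOrder 0ℓ 0ℓ 0ℓ
≥ᵉ-decTotalOrder n = On.decTotalOrder (Flip.decTotalOrder ≤-decTotalOrder) (exit {n})

Descending : List (Interval n) → Set
Descending = Sorted (DecTotalOrder.totalOrder (≥ᵉ-decTotalOrder _))

mergePairs-length : ∀ (q acc : List (List (Interval n))) →
                    length (mergePairs q acc) ≡ ⌈ length q /2⌉ + length acc
mergePairs-length (x ∷ y ∷ q) acc = begin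
  length (mergePairs q (acc ++ [ merge _≥ᵉ?_ x y ]))        ≡⟨ mergePairs-length q _ ⟩
  ⌈ length q /2⌉ + length (acc ++ [ merge _≥ᵉ?_ x y ])      ≡⟨ cong (⌈ length q /2⌉ +_) (trans (length-++ acc) (+-comm _ 1)) ⟩
  ⌈ length q /2⌉ + suc (length acc)                         ≡⟨ +-suc _ _ ⟩
  suc (⌈ length q /2⌉ + length acc)                         ∎
  where open ≡-Reasoning
mergePairs-length (x ∷ [])    acc = refl
mergePairs-length []          acc = refl

mergePairs-↭ : ∀ (q acc : List (List (Interval n))) → concat (mergePairs q acc) ↭ concat q ++ concat acc
mergePairs-↭ (x ∷ y ∷ q) acc = begin
  concat (mergePairs q (acc ++ [ merge _≥ᵉ?_ x y ]))          ↭⟨ mergePairs-↭ q _ ⟩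
  concat q ++ concat (acc ++ [ merge _≥ᵉ?_ x y ])             ≡⟨ cong (concat q ++_) (concat-++ acc [ merge _≥ᵉ?_ x y ]) ⟨
  concat q ++ (concat acc ++ (merge _≥ᵉ?_ x y ++ []))         ≡⟨ cong (λ z → concat q ++ (concat acc ++ z)) (++-identityʳ _) ⟩
  concat q ++ (concat acc ++ merge _≥ᵉ?_ x y)                 ↭⟨ ++⁺ˡ (concat q) (++⁺ˡ (concat acc) (merge-↭ _≥ᵉ?_ x y)) ⟩
  concat q ++ (concat acc ++ (x ++ y))                        ≡⟨ ++-assoc (concat q) _ _ ⟨
  (concat q ++ concat acc) ++ (x ++ y)                        ↭⟨ ++-comm (concat q ++ concat acc) _ ⟩
  (x ++ y) ++ (concat q ++ concat acc)                        ≡⟨ ++-assoc x y _ ⟩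
  x ++ (y ++ (concat q ++ concat acc))                        ≡⟨ cong (x ++_) (++-assoc y _ _) ⟨
  x ++ ((y ++ concat q) ++ concat acc)                        ≡⟨ ++-assoc x _ _ ⟨
  (x ++ (y ++ concat q)) ++ concat acc                        ∎
  where open PermutationReasoning
mergePairs-↭ (x ∷ [])    acc = ↭-reflexive (cong (_++ concat acc) (sym (++-identityʳ x)))
mergePairs-↭ []          acc = ↭-refl

mergePairs-descending : ∀ {q acc : List (List (Interval n))} →
                        All Descending q → All Descending acc → All Descending (mergePairs q acc)
mergePairs-descending {n} (x ∷ y ∷ q) acc =
  mergePairs-descending q (All.++⁺ acc (merge⁺ (≥ᵉ-decTotalOrder n) x y ∷ []))
mergePairs-descending (x ∷ [])    acc = x ∷ acc
mergePairs-descending []          acc = acc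

mergePairs-weight : ∀ (q : List (List (Interval n))) → weight (mergePairs q []) ≤ weight q
mergePairs-weight q = +-mono-≤
  (≤-reflexive (trans (↭-length (mergePairs-↭ q [])) (cong length (++-identityʳ (concat q)))))
  (≤-trans (≤-reflexive (trans (mergePairs-length q []) (+-identityʳ _))) (⌈n/2⌉≤n (length q)))

-- Recursion is on `d`, which bounds the rounds still to come: halving the number of runs, rounded
-- up, lowers its `⌈log₂_⌉` by one. Weights never grow, so a fixed `w` bounds the cost of every
-- round.
mergeQueue-run : ∀ {c s} (q : List (List (Interval n))) d w →
                 1 ≤ length q → ⌈log₂ length q ⌉ ≤ d → weight q ≤ w →
                 All Descending q → Sorting c q s →
                 Run mergeQueue s (d * (w * PassCost) + 4)
                     (λ s → ∃[ x ] (Sorting c [ x ] s × Descending x × x ↭ concat q))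
mergeQueue-run (x ∷ []) d w _ _ _ (desc ∷ []) st =
  run-≤ (m≤n+m 4 _) (run-stop (cong (_∸ 1) (Sorting.runs st)) (x , st , desc , ↭-reflexive (sym (++-identityʳ x))))
mergeQueue-run (x ∷ y ∷ q) zero w _ d≥ _ _ _ = contradiction
  (≤-trans (⌈log₂⌉-mono-≤ {2} {2 + length q} (s≤s (s≤s z≤n))) d≥) λ ()
mergeQueue-run {c = c} {s} q@(_ ∷ _ ∷ _) (suc d) w _ d≥ w≥ desc st =
  run-≤ (≤-trans (+-monoˡ-≤ _ (*-monoˡ-≤ PassCost w≥)) (≤-reflexive (sym (+-assoc (w * PassCost) _ 4))))
    (pass-run q [] (subst (λ q → Sorting c q s) (sym (++-identityʳ q)) st) λ st →
      run-map (λ (x , st , desc , x↭) →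
                x , st , desc , ↭-trans x↭ (↭-trans (mergePairs-↭ q []) (↭-reflexive (++-identityʳ (concat q)))))
        (mergeQueue-run (mergePairs q []) d w
          (≤-trans (s≤s z≤n) (≤-reflexive (sym len)))
          (≤-trans (≤-reflexive (trans (cong ⌈log₂_⌉ len) (⌈log₂⌈n/2⌉⌉≡⌈log₂n⌉∸1 (length q)))) (∸-monoˡ-≤ 1 d≥))
          (≤-trans (mergePairs-weight q) w≥) (mergePairs-descending desc []) st))
  where
  len : length (mergePairs q []) ≡ ⌈ length q /2⌉
  len = trans (mergePairs-length q []) (+-identityʳ _)

-- Reading the input

between : Fin n → ℕ → ℕ → List (Interval n)
between v a b with a <? b
... | yes a<b = [ interval v a b a<b ]
... | no  _   = []

-- a ∸ (a ∸ b) and a + (b ∸ a) are the minimum and the maximum of a and b.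

intervals : Fin n → List ℕ → List (Interval n)
intervals v (a ∷ b ∷ []) = between v (a ∸ (a ∸ b)) (a + (b ∸ a))
intervals v _            = []

record Reading (k : ℕ) (xs : List ℕ) (c : ℕ) (q : List (List (Interval n))) (s : State) : Set where
  constructor reading
  field
    count   : s at Count ≡ k
    unread  : input s ≡ xs
    pending : Sorting c q s

insert-sorting : ∀ {c q} (r : Interval n) s → Sorting c q s →
                 s at Exit ≡ exit r → s at Enter ≡ enter r → s at Leaf ≡ toℕ (leaf r) →
                 Sorting c (q ++ [ [ r ] ]) (exec insert s)
insert-sorting {q = q} r s (sorting k ce f o qu) ex en le =
  sorting (trans (cong suc k) (trans (+-comm 1 (length q)) (sym (length-++ q)))) ce f o
    (append-run {μ = memory s} qu
      (cons (trans (write₃-0 (memory s) t a b c) ex) (trans (write₃-1 (memory s) t a b c) en)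
            (trans (write₃-2 (memory s) t a b c) le) [])
      (write₃-keeps (memory s) t a b c))
  where
  t = s at Top
  a = s at Exit
  b = s at Enter
  c = s at Leaf

-- The exact duration of the longest path through `readBlock`, taken when an interval is inserted;
-- the other paths are padded by `run-≤`.
BlockCost : ℕ
BlockCost = 60

readBlock-run : ∀ {k c s q rest} (v : Fin n) ls → length ls ≤ 2 →
                Reading (suc k) (toℕ v ∷ length ls ∷ ls ++ rest) c q s →
                Run readBlock s BlockCost (Reading k rest c (q ++ map [_] (intervals v ls)))
readBlock-run {q = q} v [] _ (reading n refl (sorting k ce f o qu)) =
  run-≤ (≤ᵇ⇒≤ 9 60 _)
    (straight-then (Count ≔ reg Count ⊖ const 1 ⨾ read Leaf ⨾ read Size)
    (run-else refl (straight skip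
    (reading (cong (_∸ 1) n) refl (subst (λ q → Sorting _ q _) (sym (++-identityʳ q)) (sorting k ce f o qu))))))
readBlock-run {q = q} v (a ∷ []) _ (reading n refl (sorting k ce f o qu)) =
  run-≤ (≤ᵇ⇒≤ 14 60 _)
    (straight-then (Count ≔ reg Count ⊖ const 1 ⨾ read Leaf ⨾ read Size)
    (run-then (λ ()) (straight-then (read Enter)
    (run-else refl (straight skip
    (reading (cong (_∸ 1) n) refl (subst (λ q → Sorting _ q _) (sym (++-identityʳ q)) (sorting k ce f o qu))))))))
readBlock-run {q = q} v (a ∷ b ∷ []) _ (reading n refl (sorting k ce f o qu))
  with a ∸ (a ∸ b) <? a + (b ∸ a)
... | yes a<b =
  straight-then (Count ≔ reg Count ⊖ const 1 ⨾ read Leaf ⨾ read Size)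
  (run-then (λ ()) (straight-then (read Enter)
  (run-then (λ ()) (straight-then order
  (run-then (m>n⇒m∸n≢0 a<b) (straight insert
  (reading (cong (_∸ 1) n) refl (insert-sorting (interval v (a ∸ (a ∸ b)) (a + (b ∸ a)) a<b) _ (sorting k ce f o qu) refl refl refl))))))))
... | no a≮b =
  run-≤ (≤ᵇ⇒≤ 33 60 _)
    (straight-then (Count ≔ reg Count ⊖ const 1 ⨾ read Leaf ⨾ read Size)
    (run-then (λ ()) (straight-then (read Enter)
    (run-then (λ ()) (straight-then order
    (run-else (m≤n⇒m∸n≡0 (≮⇒≥ a≮b)) (straight skip
    (reading (cong (_∸ 1) n) refl (subst (λ q → Sorting _ q _) (sym (++-identityʳ q)) (sorting k ce f o qu))))))))))
readBlock-run v (_ ∷ _ ∷ _ ∷ _) (s≤s (s≤s ()))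

readAll-run : ∀ {c} (ls : Fin n → List ℕ) k vs {s q} → length vs ≤ k → All (λ v → length (ls v) ≤ 2) vs →
              Reading k (concatMap (λ v → toℕ v ∷ length (ls v) ∷ ls v) vs) c q s →
              Run readAll s (k * (2 + BlockCost) + 2)
                  (Sorting c (q ++ map [_] (concatMap (λ v → intervals v (ls v)) vs)))
readAll-run ls zero [] _ _ (reading n i st) =
  run-stop n (subst (λ q → Sorting _ q _) (sym (++-identityʳ _)) st)
readAll-run ls (suc k) [] _ [] (reading n refl (sorting r ce f o qu)) =
  run-iterate (λ eq → 1+n≢0 (trans (sym n) eq))
    (run-≤ (≤ᵇ⇒≤ 9 60 _)
      (straight-then (Count ≔ reg Count ⊖ const 1 ⨾ read Leaf ⨾ read Size)
      (run-else refl (straight skip (reading (cong (_∸ 1) n) refl (sorting r ce f o qu))))))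
    (readAll-run ls k [] z≤n [])
readAll-run ls (suc k) (v ∷ vs) {s} {q} (s≤s l) (ok ∷ oks) (reading n i st) =
  run-iterate (λ eq → 1+n≢0 (trans (sym n) eq))
    (readBlock-run v (ls v) ok (reading n i st))
    λ rd → run-map (λ {s} → subst (λ q → Sorting _ q s)
        (trans (++-assoc q _ _) (cong (q ++_) (sym (map-++ [_] (intervals v (ls v)) _)))))
      (readAll-run ls k vs l oks rd)

-- Greedy selection and output

greedy : ℕ → List (Interval n) → List (Interval n)
greedy t []       = []
greedy t (r ∷ rs) with t <? enter r
... | yes _ = r ∷ greedy (exit r) rs
... | no  _ = greedy t rs

tour : Fin n → List (Interval n) → List (TimeEdge n)
tour c []       = []
tour c (r ∷ rs) = timeEdge c (leaf r) (enter r) ∷ timeEdge (leaf r) c (exit r) ∷ tour c rs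

-- The sorted run is descending, so it is consumed from its end downwards.

record Scheduling (c : Fin n) (rs : List (Interval n)) (t : ℕ) (ys : List ℕ) (s : State) : Set where
  constructor scheduling
  field
    centre  : s at Center ≡ toℕ c
    finish  : s at Finish ≡ t
    {limit} : ℕ
    next    : s at Next ≡ limit
    stored  : Stored (memory s) (s at Head) (reverse rs) limit
    out     : output s ++ encodeJourney (tour c (greedy t rs)) ≡ ys

-- `select` emits the two time edges of an interval as six separate numbers.
snoc₆ : ∀ (xs : List ℕ) {a b c d e f ys} →
        ((((((xs ++ [ a ]) ++ [ b ]) ++ [ c ]) ++ [ d ]) ++ [ e ]) ++ [ f ]) ++ ys ≡
        xs ++ a ∷ b ∷ c ∷ d ∷ e ∷ f ∷ ys
snoc₆ xs {a} {b} {c} {d} {e} {f} {ys} =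
  trans (∷ʳ-++ xs₅ f ys) (trans (∷ʳ-++ xs₄ e _) (trans (∷ʳ-++ xs₃ d _)
    (trans (∷ʳ-++ xs₂ c _) (trans (∷ʳ-++ xs₁ b _) (∷ʳ-++ xs a _)))))
  where
  xs₁ = xs ++ [ a ]
  xs₂ = xs₁ ++ [ b ]
  xs₃ = xs₂ ++ [ c ]
  xs₄ = xs₃ ++ [ d ]
  xs₅ = xs₄ ++ [ e ]

-- 9 for `back`, 4 for the test and 22 for `select`; a rejected interval costs only 14.
VisitCost : ℕ
VisitCost = 35

visit-run : ∀ {c t ys s} (r : Interval n) {rs m} →
  s at Center ≡ toℕ c → s at Finish ≡ t → s at Next ≡ 3 + m → Stored (memory s) (s at Head) (reverse rs) m →
  memory s m ≡ exit r → memory s (1 + m) ≡ enter r → memory s (2 + m) ≡ toℕ (leaf r) →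
  output s ++ encodeJourney (tour c (greedy t (r ∷ rs))) ≡ ys →
  Run visit s VisitCost (λ s → ∃[ t ] Scheduling c rs t ys s)
visit-run {t = t} {s = s} r {rs} ce refl nx st ex en le o with s at Finish <? enter r
... | yes t<a =
  straight-then back
  (run-then (λ eq → m>n⇒m∸n≢0 t<a (trans (cong (_∸ s at Finish) (sym en′)) eq))
  (straight select (exit r , scheduling ce ex′ (cong (_∸ 3) nx) st
     (trans (cong₄ (λ a b c d → ((((((output s ++ [ a ]) ++ [ b ]) ++ [ c ]) ++ [ b ]) ++ [ a ]) ++ [ d ]) ++ ys) ce le′ en′ ex′)
       (trans (snoc₆ (output s)) o)))))
  where
  ys = _
  ex′ = trans (cong (λ i → memory s (i ∸ 3)) nx) ex
  en′ = trans (cong (λ i → memory s (1 + (i ∸ 3))) nx) en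
  le′ = trans (cong (λ i → memory s (2 + (i ∸ 3))) nx) le
  cong₄ : ∀ {A B C D E : Set} (f : A → B → C → D → E) {a a′ b b′ c c′ d d′} →
          a ≡ a′ → b ≡ b′ → c ≡ c′ → d ≡ d′ → f a b c d ≡ f a′ b′ c′ d′
  cong₄ f refl refl refl refl = refl
... | no t≮a =
  run-≤ (≤ᵇ⇒≤ 14 35 _)
  (straight-then back
  (run-else (trans (cong (_∸ s at Finish) en′) (m≤n⇒m∸n≡0 (≮⇒≥ t≮a)))
  (straight skip (s at Finish , scheduling ce refl (cong (_∸ 3) nx) st o))))
  where
  en′ = trans (cong (λ i → memory s (1 + (i ∸ 3))) nx) en

schedule-run : ∀ {c t ys s} (rs : List (Interval n)) → Scheduling c rs t ys s →
               Run schedule s (length rs * (4 + VisitCost) + 4) (λ s → output s ≡ ys)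
schedule-run {s = s} [] (scheduling _ _ nx [] o) =
  run-stop (trans (cong (_∸ s at Head) nx) (n∸n≡0 (s at Head))) (trans (sym (++-identityʳ _)) o)
schedule-run {s = s} (r ∷ rs) (scheduling ce fi nx st o)
  -- Reversal puts `r` last, hence into the three words just below `Next`.
  with m , st , cons ex en le [] ← stored-++⁻ (reverse rs) (subst (λ rs → Stored _ _ rs _) (unfold-reverse r rs) st) =
  run-iterate (λ eq → m>n⇒m∸n≢0 (s≤s (≤-trans (stored-≤ st) (m≤n+m m 2))) (trans (cong (_∸ s at Head) (sym nx)) eq))
    (visit-run r ce fi nx st ex en le o) λ (_ , sch) → schedule-run rs sch

-- Optimality of the greedy choice

AllPairs-reverse : ∀ {R : Rel A 0ℓ} {xs} → AllPairs R xs → AllPairs (flip R) (reverse xs)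
AllPairs-reverse [] = []
AllPairs-reverse {R = R} {x ∷ xs} (px ∷ pxs) = subst (AllPairs (flip R)) (sym (unfold-reverse x xs))
  (AllPairs.++⁺ (AllPairs-reverse pxs) ([] ∷ []) (All.map (λ r → r ∷ []) (All-resp-↭ (↭-sym (↭-reverse xs)) px)))

-- Pigeonhole, used both ways between leaves and intervals: it bounds the size of a tour from below
-- and that of an arbitrary exploration from above.
Unique⇒length-≤ : ∀ {xs ys : List A} → Unique xs → (∀ {x} → x ∈ xs → x ∈ ys) → length xs ≤ length ys
Unique⇒length-≤ [] _ = z≤n
Unique⇒length-≤ {xs = x ∷ xs} (x≢ ∷ u) ⊆ys with as , bs , refl ← ∈-∃++ (⊆ys (here refl)) = begin
  suc (length xs)               ≤⟨ s≤s (Unique⇒length-≤ u ⊆rest) ⟩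
  suc (length (as ++ bs))       ≡⟨ cong suc (length-++ as) ⟩
  suc (length as + length bs)   ≡⟨ +-suc (length as) (length bs) ⟨
  length as + suc (length bs)   ≡⟨ length-++ as ⟨
  length (as ++ x ∷ bs)         ∎
  where
  open ≤-Reasoning
  ⊆rest : ∀ {y} → y ∈ xs → y ∈ as ++ bs
  ⊆rest y∈ with ∈-++⁻ as (⊆ys (there y∈))
  ... | inj₁ y∈as         = ∈-++⁺ˡ y∈as
  ... | inj₂ (here refl)  = contradiction refl (All.lookup x≢ y∈)
  ... | inj₂ (there y∈bs) = ∈-++⁺ʳ as y∈bs

data Compatible : ℕ → List (Interval n) → Set where
  []  : ∀ {t} → Compatible {n} t []
  _∷_ : ∀ {t r} {rs : List (Interval n)} → t < enter r → Compatible (exit r) rs → Compatible t (r ∷ rs)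

compatible-mono : ∀ {t u} {rs : List (Interval n)} → t ≤ u → Compatible u rs → Compatible t rs
compatible-mono _   []          = []
compatible-mono t≤u (u<a ∷ cs) = ≤-<-trans t≤u u<a ∷ cs

compatible⇒enter> : ∀ {t} {rs : List (Interval n)} → Compatible t rs → All (λ r → t < enter r) rs
compatible⇒enter> [] = []
compatible⇒enter> (_∷_ {r = r} t<a cs) =
  t<a ∷ All.map (<-trans (<-trans t<a (enter<exit′ r))) (compatible⇒enter> cs)

greedy-compatible : ∀ t (rs : List (Interval n)) → Compatible t (greedy t rs)
greedy-compatible t []       = []
greedy-compatible t (r ∷ rs) with t <? enter r
... | yes t<a = t<a ∷ greedy-compatible (exit r) rs
... | no  _   = greedy-compatible t rs

greedy-⊆ : ∀ t (rs : List (Interval n)) {q} → q ∈ greedy t rs → q ∈ rs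
greedy-⊆ t (r ∷ rs) q∈ with t <? enter r
greedy-⊆ t (r ∷ rs) (here q≡r) | yes _ = here q≡r
greedy-⊆ t (r ∷ rs) (there q∈) | yes _ = there (greedy-⊆ (exit r) rs q∈)
greedy-⊆ t (r ∷ rs) q∈         | no  _ = there (greedy-⊆ t rs q∈)

-- Every member of `qs` is entered after `t`, so none of them is `r`. The premise `enter r ≤ t`
-- covers both outcomes of the greedy test: `r` chosen, with `t` its exit, and `r` rejected.
∈-tail : ∀ {t r} {rs : List (Interval n)} {qs} → enter r ≤ t → Compatible t qs → All (_∈ r ∷ rs) qs → All (_∈ rs) qs
∈-tail {r = r} a≤t cs qs∈ = All.zipWith strip (compatible⇒enter> cs , qs∈)
  where
  strip : ∀ {q rs} → (_ < enter q) × (q ∈ r ∷ rs) → q ∈ rs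
  strip (t<a , here refl) = contradiction a≤t (<⇒≱ t<a)
  strip (_   , there q∈)  = q∈

-- Exchange argument: the first interval of a compatible sequence can be replaced by the one that exits first.

greedy-optimal : ∀ {t} {rs qs : List (Interval n)} → AllPairs (flip _≥ᵉ_) rs →
                 Compatible t qs → All (_∈ rs) qs → length qs ≤ length (greedy t rs)
greedy-optimal _ [] _ = z≤n
greedy-optimal {t = t} {r ∷ rs} (r≤ ∷ asc) (t<a ∷ cs) qs∈@(q∈ ∷ qs∈′) with t <? enter r
... | yes _  = s≤s (greedy-optimal asc cs′ (∈-tail (<⇒≤ (enter<exit′ r)) cs′ qs∈′))
  where
  exit≤ : ∀ {q} → q ∈ r ∷ rs → exit r ≤ exit q
  exit≤ (here refl) = ≤-refl
  exit≤ (there q∈)  = All.lookup r≤ q∈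
  cs′ = compatible-mono (exit≤ q∈) cs
... | no t≮a = greedy-optimal asc (t<a ∷ cs) (∈-tail (≮⇒≥ t≮a) (t<a ∷ cs) qs∈)

-- Labels of an edge and the interval they bound

between-yes : ∀ {v : Fin n} {a b} (a<b : a < b) → between v a b ≡ [ interval v a b a<b ]
between-yes {a = a} {b} a<b with a <? b
... | yes _  = refl
... | no a≮b = contradiction a<b a≮b

∈-between⁻ : ∀ {v : Fin n} {a b r} → r ∈ between v a b → leaf r ≡ v × enter r ≡ a × exit r ≡ b
∈-between⁻ {a = a} {b} r∈ with a <? b
∈-between⁻ (here refl) | yes _ = refl , refl , refl

between-unique : ∀ {v : Fin n} {a b r r′} → r ∈ between v a b → r′ ∈ between v a b → r ≡ r′
between-unique {a = a} {b} r∈ r∈′ with a <? b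
between-unique (here refl) (here refl) | yes _ = refl

intervals-unique : ∀ {v : Fin n} ls {r r′} → r ∈ intervals v ls → r′ ∈ intervals v ls → r ≡ r′
intervals-unique (a ∷ b ∷ []) = between-unique

intervals-length : ∀ (v : Fin n) ls → length (intervals v ls) ≤ 1
intervals-length v []               = z≤n
intervals-length v (_ ∷ [])         = z≤n
intervals-length v (a ∷ b ∷ []) with a ∸ (a ∸ b) <? a + (b ∸ a)
... | yes _ = ≤-refl
... | no  _ = z≤n
intervals-length v (_ ∷ _ ∷ _ ∷ _)  = z≤n

∈-intervals⁻ : ∀ {v : Fin n} ls {r} → r ∈ intervals v ls → leaf r ≡ v × enter r ∈ ls × exit r ∈ ls
∈-intervals⁻ (a ∷ b ∷ []) r∈ with leaf≡ , enter≡ , exit≡ ← ∈-between⁻ r∈ | ≤-total a b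
... | inj₁ a≤b = leaf≡ , here (trans enter≡ (cong (a ∸_) (m≤n⇒m∸n≡0 a≤b))) ,
                 there (here (trans exit≡ (m+[n∸m]≡n a≤b)))
... | inj₂ b≤a = leaf≡ , there (here (trans enter≡ (m∸[m∸n]≡n b≤a))) ,
                 here (trans exit≡ (trans (cong (a +_) (m≤n⇒m∸n≡0 b≤a)) (+-identityʳ a)))

-- The limit on the number of labels enters here: `intervals` yields nothing for longer lists. As
-- `a < b`, the two labels occupy different positions, in either order.
∈-intervals⁺ : ∀ {v : Fin n} ls {a b} (a<b : a < b) → length ls ≤ 2 → a ∈ ls → b ∈ ls →
               interval v a b a<b ∈ intervals v ls
∈-intervals⁺ (x ∷ [])     a<b _ (here refl) (here refl) = contradiction a<b (<-irrefl refl)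
∈-intervals⁺ (x ∷ y ∷ []) a<b _ (here refl) (here refl) = contradiction a<b (<-irrefl refl)
∈-intervals⁺ (x ∷ y ∷ []) a<b _ (there (here refl)) (there (here refl)) = contradiction a<b (<-irrefl refl)
∈-intervals⁺ {v = v} (x ∷ y ∷ []) a<b _ (here refl) (there (here refl))
  rewrite m≤n⇒m∸n≡0 (<⇒≤ a<b) | m+[n∸m]≡n (<⇒≤ a<b) | between-yes {v = v} a<b = here refl
∈-intervals⁺ {v = v} (x ∷ y ∷ []) a<b _ (there (here refl)) (here refl)
  rewrite m∸[m∸n]≡n (<⇒≤ a<b) | m≤n⇒m∸n≡0 (<⇒≤ a<b) | +-identityʳ x | between-yes {v = v} a<b = here refl
∈-intervals⁺ (_ ∷ _ ∷ _ ∷ _) _ (s≤s (s≤s ()))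

-- Explorations as sequences of compatible intervals

module Star {n} (S : TemporalStar n) (two : AtMostLabels 2 (TemporalStar.temporalGraph S)) where
  open TemporalStar S

  labelled : Fin n → List (Interval n)
  labelled v = intervals v (labels center v)

  available : List (Interval n)
  available = concatMap labelled (leaves S)

  ∈-leaves⇒~ : ∀ {v} → v ∈ leaves S → center ~ v
  ∈-leaves⇒~ v∈ = Equivalence.from (isStar _ _) (inj₁ (refl , proj₂ (∈-filter⁻ _ {xs = allFin n} v∈)))

  ~⇒∈-leaves : ∀ {v} → center ~ v → v ∈ leaves S
  ~⇒∈-leaves {v} c~v = ∈-filter⁺ _ (∈-allFin v) λ v≡c → ~-irr (sym v≡c) c~v

  ∈-available⁻ : ∀ {r} → r ∈ available → leaf r ∈ leaves S × r ∈ labelled (leaf r)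
  ∈-available⁻ r∈ = from-any (leaves S) (∈-concatMap⁻ labelled r∈)
    where
    from-any : ∀ vs {r} → Any (λ v → r ∈ labelled v) vs → leaf r ∈ vs × r ∈ labelled (leaf r)
    from-any (v ∷ vs) (here r∈) with refl , _ ← ∈-intervals⁻ (labels center v) r∈ = here refl , r∈
    from-any (v ∷ vs) (there r∈) with p , q ← from-any vs r∈ = there p , q

  ∈-available⁺ : ∀ {r} → center ~ leaf r → r ∈ labelled (leaf r) → r ∈ available
  ∈-available⁺ c~v r∈ = ∈-concatMap⁺ labelled (lose (~⇒∈-leaves c~v) r∈)

  leaf-injective : ∀ {r r′} → r ∈ available → r′ ∈ available → leaf r ≡ leaf r′ → r ≡ r′
  leaf-injective {r} {r′} r∈ r∈′ eq = intervals-unique (labels center (leaf r))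
    (proj₂ (∈-available⁻ r∈)) (subst (λ v → r′ ∈ labelled v) (sym eq) (proj₂ (∈-available⁻ r∈′)))

  leaves-length : length (leaves S) ≤ n
  leaves-length = ≤-trans (length-filter _ (allFin n)) (≤-reflexive (length-tabulate {n = n} λ i → i))

  available-length : length available ≤ n
  available-length = ≤-trans (go (leaves S)) leaves-length
    where
    go : ∀ vs → length (concatMap labelled vs) ≤ length vs
    go []       = z≤n
    go (v ∷ vs) rewrite length-++ (labelled v) {concatMap labelled vs} = +-mono-≤ (intervals-length v (labels center v)) (go vs)

  -- A repeated leaf would mean a repeated interval by `leaf-injective`, yet the later one is
  -- entered strictly after the earlier one was.
  leaves-unique : ∀ {t rs} → Compatible t rs → All (_∈ available) rs → Unique (map leaf rs)
  leaves-unique [] [] = []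
  leaves-unique (_∷_ {r = r} {rs} t<a cs) (r∈ ∷ rs∈) = All.tabulate distinct ∷ leaves-unique cs rs∈
    where
    distinct : ∀ {v} → v ∈ map leaf rs → leaf r ≢ v
    distinct v∈ with q , q∈ , refl ← ∈-map⁻ leaf v∈ = λ eq →
      <⇒≱ (<-trans (enter<exit′ r) (All.lookup (compatible⇒enter> cs) q∈))
          (≤-reflexive (cong enter (sym (leaf-injective r∈ (All.lookup rs∈ q∈) eq))))

  tour-walk : ∀ rs → All (_∈ available) rs → Walk temporalGraph center center (tour center rs)
  tour-walk []       []         = []
  tour-walk (r ∷ rs) (r∈ ∷ rs∈) with v∈ , r∈′ ← ∈-available⁻ r∈ with _ , a∈ , b∈ ← ∈-intervals⁻ _ r∈′ =
    (c~v , a∈) ∷ (~-sym c~v , subst (exit r ∈_) (labels-sym c~v) b∈) ∷ tour-walk rs rs∈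
    where c~v = ∈-leaves⇒~ v∈

  tour-linked : ∀ {t rs} → Compatible t rs → Linked (_<_ on time) (tour center rs)
  tour-linked []                           = []
  tour-linked (_∷_ {r = r} _ [])           = enter<exit′ r ∷ [-]
  tour-linked (_∷_ {r = r} _ cs@(b<a ∷ _)) = enter<exit′ r ∷ (b<a ∷ tour-linked cs)

  tour-targets : ∀ rs {v} → v ∈ map leaf rs → v ∈ map target (tour center rs)
  tour-targets (r ∷ rs) (here v≡)  = here v≡
  tour-targets (r ∷ rs) (there v∈) = there (there (tour-targets rs v∈))

  tour-size : ∀ {t rs} → Compatible t rs → All (_∈ available) rs → length rs ≤ size S (tour center rs)
  tour-size {rs = rs} cs rs∈ = subst (_≤ size S (tour center rs)) (length-map leaf rs)
    (Unique⇒length-≤ (leaves-unique cs rs∈) λ v∈ → ∈-filter⁺ _ (is-leaf v∈) (tour-targets rs v∈))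
    where
    is-leaf : ∀ {v} → v ∈ map leaf rs → v ∈ leaves S
    is-leaf v∈ with r , r∈ , refl ← ∈-map⁻ leaf v∈ = proj₁ (∈-available⁻ (All.lookup rs∈ r∈))

  record Visits (t : ℕ) (es : List (TimeEdge n)) : Set where
    constructor visits
    field
      {visited}   : List (Interval n)
      compatible  : Compatible t visited
      feasible    : All (_∈ available) visited
      covers      : ∀ {v} → v ≢ center → v ∈ map target es → v ∈ map leaf visited

  -- Every other vertex of a walk in a star is the center, so time edges are consumed in pairs, into
  -- a leaf and back; increasing times make each pair an interval. The endpoints are variables
  -- equated with the center so that the indices of `Walk` can be matched on.
  walk-visits : ∀ {u w t} es → u ≡ center → w ≡ center → Walk temporalGraph u w es →
                All (λ e → t < time e) es → AllPairs (_<_ on time) es → Visits t es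
  walk-visits [] _ _ [] _ _ = visits [] [] λ _ ()
  walk-visits (timeEdge u v a ∷ []) refl refl ((c~c , _) ∷ []) _ _ = contradiction c~c (~-irr refl)
  walk-visits (timeEdge u v a ∷ timeEdge _ w b ∷ es) refl w≡c ((c~v , a∈) ∷ (v~w , b∈) ∷ walk)
    (t<a ∷ _) ((a<b ∷ _) ∷ (b< ∷ asc)) with Equivalence.to (isStar v w) v~w
  ... | inj₁ (v≡c , _) = contradiction c~v (~-irr (sym v≡c))
  ... | inj₂ (_ , refl) with visits {qs} cs qs∈ cov ← walk-visits es refl w≡c walk b< asc =
    visits (_∷_ {r = interval v a b a<b} t<a cs)
      (∈-available⁺ c~v (∈-intervals⁺ (labels center v) a<b (two c~v) a∈ (subst (b ∈_) (sym (labels-sym c~v)) b∈)) ∷ qs∈)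
      λ { v≢c (here refl)         → here refl
        ; v≢c (there (here refl)) → contradiction refl v≢c
        ; v≢c (there (there v∈))  → there (cov v≢c v∈) }

  -- This makes 0 a valid initial finishing time: even the first interval is entered strictly after
  -- it.
  positive : ∀ {u w es} → Walk temporalGraph u w es → All (λ e → 0 < time e) es
  positive []                  = []
  positive ((u~v , a∈) ∷ walk) = All.lookup (labels-positive u~v) a∈ ∷ positive walk

  exploration-size : ∀ {es} → IsExploration S es →
                     ∃[ qs ] (Compatible 0 qs × All (_∈ available) qs × size S es ≤ length qs)
  exploration-size {es} (walk , asc)
    with visits {qs} cs qs∈ cov ← walk-visits es refl refl walk (positive walk) (Linked⇒AllPairs <-trans asc) =
    qs , cs , qs∈ , subst (size S es ≤_) (length-map leaf qs)
      (Unique⇒length-≤ (Unique.filter⁺ _ (Unique.filter⁺ _ (Unique.allFin⁺ n))) λ v∈ →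
        let v∈leaves , v∈es = ∈-filter⁻ _ {xs = leaves S} v∈ in
        cov (proj₂ (∈-filter⁻ _ {xs = allFin n} v∈leaves)) v∈es)

  greedy-maximum : ∀ {rs} → AllPairs (flip _≥ᵉ_) rs → rs ↭ available →
                   IsMaximumExploration S (tour center (greedy 0 rs))
  greedy-maximum {rs} asc rs↭ =
    (tour-walk (greedy 0 rs) chosen , tour-linked (greedy-compatible 0 rs)) ,
    λ es′ exp → let qs , cs , qs∈ , size≤ = exploration-size exp in
      ≤-trans size≤ (≤-trans (greedy-optimal asc cs (All.map (∈-resp-↭ (↭-sym rs↭)) qs∈))
        (tour-size (greedy-compatible 0 rs) chosen))
    where
    chosen : All (_∈ available) (greedy 0 rs)
    chosen = All.tabulate (∈-resp-↭ rs↭ ∘ greedy-⊆ 0 rs)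

-- The whole program and its running time

queue-last : ∀ {μ i x t} → Queue μ {n} i [ x ] t → ∃[ e ] (Stored μ i x e × t ≡ 1 + e)
queue-last (cons x _ []) = _ , x , refl

-- At most `n` singleton runs and one empty run give at most `1 + n` runs, of weight at most
-- `n + (1 + n)`. In `runTime`, 9 is the duration of `start` and the first 4 in the last group sets
-- `Next`.
mergeBound runTime : ℕ → ℕ
mergeBound n = ⌈log₂ (1 + n) ⌉ * ((1 + (n + n)) * PassCost) + 4
runTime n = 9 + (n * (2 + BlockCost) + 2 + (mergeBound n + (4 + (n * (4 + VisitCost) + 4))))

module Execution {n} (S : TemporalStar n) (two : AtMostLabels 2 (TemporalStar.temporalGraph S)) where
  open TemporalStar S
  open Star S two

  singletons : List (List (Interval n))
  singletons = map [_] available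

  -- The empty run keeps the queue nonempty even if no edge has two labels.

  queue₀ : List (List (Interval n))
  queue₀ = [] ∷ singletons

  length-queue₀ : length queue₀ ≤ 1 + n
  length-queue₀ = s≤s (≤-trans (≤-reflexive (length-map [_] available)) available-length)

  weight-queue₀ : weight queue₀ ≤ 1 + (n + n)
  weight-queue₀ = ≤-trans (+-mono-≤ (≤-trans (≤-reflexive (cong length (concat-map-[_] available))) available-length) length-queue₀)
    (≤-reflexive (+-suc n n))

  singletons-descending : ∀ (rs : List (Interval n)) → All Descending (map [_] rs)
  singletons-descending []       = []
  singletons-descending (r ∷ rs) = [-] ∷ singletons-descending rs

  Result : State → Set
  Result s = ∃[ rs ] (rs ↭ available × AllPairs (flip _≥ᵉ_) rs ×
                      output s ≡ encodeJourney (tour center (greedy 0 rs)))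

  scheduled : ∀ {x s} → Sorting {n} (toℕ center) [ x ] s → Descending x → x ↭ concat queue₀ →
              Run (Next ≔ reg Top ⊖ const 1 ⨾ schedule) s (4 + (n * (4 + VisitCost) + 4)) Result
  scheduled {x} {s} (sorting _ ce fi o qu) desc x↭ with e , st , t≡ ← queue-last qu =
    straight-then (Next ≔ reg Top ⊖ const 1)
      (run-≤ (+-monoˡ-≤ 4 (*-monoˡ-≤ (4 + VisitCost) (≤-trans (≤-reflexive (↭-length rs↭)) available-length)))
      (run-map (λ out → rs , rs↭ , AllPairs-reverse (Linked⇒AllPairs (flip ≤-trans) desc) , out)
      (schedule-run rs (scheduling ce fi (cong (_∸ 1) t≡)
        (subst (λ x → Stored (memory s) (s at Head) x e) (sym (reverse-involutive x)) st)
        (cong (_++ _) o)))))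
    where
    rs = reverse x
    rs↭ : rs ↭ available
    rs↭ = ↭-trans (↭-reverse x) (↭-trans x↭ (↭-reflexive (concat-map-[_] available)))

  execution : Run maxStarExp (initial (encodeStar S)) (runTime n) Result
  execution = straight-then start
    (readAll-run (labels center) n (leaves S) leaves-length (All.tabulate λ v∈ → two (∈-leaves⇒~ v∈))
      (reading refl refl (sorting refl refl refl refl (cons [] refl []))) >>= λ st →
    (mergeQueue-run queue₀ ⌈log₂ (1 + n) ⌉ (1 + (n + n)) (s≤s z≤n) (⌈log₂⌉-mono-≤ length-queue₀) weight-queue₀
      ([] ∷ singletons-descending available) st >>= λ (x , st , desc , x↭) → scheduled st desc x↭))

  solution : Run maxStarExp (initial (encodeStar S)) (runTime n) Result →
             ∃[ es ] (IsMaximumExploration S es × Computes maxStarExp on encodeStar S to encodeJourney es within runTime n)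
  solution (run h t≤ (rs , rs↭ , asc , out)) =
    tour center (greedy 0 rs) , greedy-maximum asc rs↭ , _ , _ , h , out , t≤

maxStarExp-solves : maxStarExp SolvesMaxStarExp⟨ 2 ⟩InTime runTime
maxStarExp-solves S two = Execution.solution S two (Execution.execution S two)

runTime-∈O : runTime ∈O (λ n → n * ⌈log₂ n ⌉)
-- 442 is 318 + 101 + 23: merging gives 2 * 3 * 53, from bounding the logarithm by `l + l` and the
-- weight by `3 * n`; reading and scheduling give 62 + 39; the constants add up to 23. The threshold
-- is 2 because `⌈log₂ 1 ⌉` is 0.
runTime-∈O = 442 , 2 , bound
  where
  open ≤-Reasoning
  expand : ∀ n l → 9 + (n * 62 + 2 + ((l + l) * ((n + n + n) * 53) + 4 + (4 + (n * 39 + 4)))) ≡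
                   318 * (n * l) + (101 * n + 23)
  expand = solve-∀
  collect : ∀ m → 318 * m + (101 * m + 23 * m) ≡ 442 * m
  collect = solve-∀
  bound : ∀ n → 2 ≤ n → runTime n ≤ 442 * (n * ⌈log₂ n ⌉)
  bound n@(suc _) 2≤n = begin
    runTime n
      ≤⟨ +-monoʳ-≤ 9 (+-monoʳ-≤ (n * 62 + 2) (+-monoˡ-≤ (4 + (n * 39 + 4)) (+-monoˡ-≤ 4
           (*-mono-≤ log≤ (*-monoˡ-≤ 53 (+-monoˡ-≤ (n + n) 1≤n)))))) ⟩
    9 + (n * 62 + 2 + ((l + l) * ((n + (n + n)) * 53) + 4 + (4 + (n * 39 + 4))))
      ≡⟨ cong (λ m → 9 + (n * 62 + 2 + ((l + l) * (m * 53) + 4 + (4 + (n * 39 + 4))))) (+-assoc n n n) ⟨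
    9 + (n * 62 + 2 + ((l + l) * ((n + n + n) * 53) + 4 + (4 + (n * 39 + 4))))
      ≡⟨ expand n l ⟩
    318 * (n * l) + (101 * n + 23)
      ≤⟨ +-monoʳ-≤ (318 * (n * l)) (+-mono-≤ (*-monoʳ-≤ 101 n≤nl) (*-monoʳ-≤ 23 (≤-trans 1≤n n≤nl))) ⟩
    318 * (n * l) + (101 * (n * l) + 23 * (n * l))
      ≡⟨ collect (n * l) ⟩
    442 * (n * l) ∎
    where
    l = ⌈log₂ n ⌉
    1≤n : 1 ≤ n
    1≤n = ≤-trans (n≤1+n 1) 2≤n
    1≤l : 1 ≤ l
    1≤l = ⌈log₂⌉-mono-≤ 2≤n
    n≤nl : n ≤ n * l
    n≤nl = ≤-trans (≤-reflexive (sym (*-identityʳ n))) (*-monoʳ-≤ n 1≤l)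
    log≤ : ⌈log₂ (1 + n) ⌉ ≤ l + l
    log≤ = begin
      ⌈log₂ (1 + n) ⌉  ≤⟨ ⌈log₂⌉-mono-≤ (≤-trans (+-monoˡ-≤ n 1≤n) (+-monoʳ-≤ n (≤-reflexive (sym (+-identityʳ n))))) ⟩
      ⌈log₂ (2 * n) ⌉  ≡⟨ ⌈log₂2*n⌉≡1+⌈log₂n⌉ n ⟩
      1 + l            ≤⟨ +-monoˡ-≤ l 1≤l ⟩
      l + l            ∎

theorem1 : ∃[ p ] ∃[ T ] ((p SolvesMaxStarExp⟨ 2 ⟩InTime T) × T ∈O (λ n → n * ⌈log₂ n ⌉))
theorem1 = maxStarExp , runTime , maxStarExp-solves , runTime-∈O
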